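{- Assume that $1\le s\le t$ and $\mathcal{F}\subset\binom{[n]}{k}$ is an $(s,t)$-union-intersecting set system. Then $$|\mathcal{F}|\le\binom{n-1}{k-1}+s-1$$ holds for all $n>n(k,t)$, where $n(k,t)$ is a threshold depending only on $k$ and $t$.
   Context: $[n]=\{1,2,\dots,n\}$, and $\binom{[n]}{k}$ denotes the set of all $k$-element subsets of $[n]$. Here $s,t,k,n$ are integers. A set system is a family of distinct sets. A set system $\mathcal{F}$ is called $(s,t)$-union-intersecting if for all $s+t$ pairwise different sets $F_1,\dots,F_s,G_1,\dots,G_t\in\mathcal{F}$, $$\left(\bigcup_{i=1}^s F_i\right)\cap\left(\bigcup_{j=1}^t G_j\right)\ne\emptyset.$$
   Formalization: The formal statement assumes k ≥ 2; for k = 1 and t ≥ 2 the claim fails (s+t−1 distinct singletons satisfy the condition vacuously but exceed the bound s), and for k = 0, s = 1 the family {∅} exceeds the bound 0. -}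

module Defs where

open import Data.Fin.Subset using (Subset; Nonempty; ∣_∣; _∩_; ⋃)
open import Data.List using (List; length; _++_)
open import Data.List.Relation.Binary.Subset.Propositional using (_⊆_)
open import Data.List.Relation.Unary.All using (All)
open import Data.List.Relation.Unary.Unique.Propositional using (Unique)
open import Data.Nat using (ℕ)
open import Relation.Binary.PropositionalEquality using (_≡_)

-- The ground set [n] = {1,…,n} is represented by Fin n.  A set system is
-- a duplicate-free list of subsets, so its cardinality is the list's length.
record SetSystem (n : ℕ) : Set where
  field
    members  : List (Subset n)
    distinct : Unique members

open SetSystem public

size : ∀ {n} → SetSystem n → ℕ
size 𝓕 = length (members 𝓕)

Uniform : ∀ {n} → ℕ → SetSystem n → Set
Uniform k 𝓕 = All (λ F → ∣ F ∣ ≡ k) (members 𝓕)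

-- Unique (Fs ++ Gs) says that all s + t chosen sets are pairwise different,
-- including each F from each G.  The condition holds vacuously for a system
-- with fewer than s + t members.
UnionIntersecting : ∀ {n} → ℕ → ℕ → SetSystem n → Set
UnionIntersecting {n} s t 𝓕 =
  (Fs Gs : List (Subset n)) →
  length Fs ≡ s → length Gs ≡ t →
  Fs ⊆ members 𝓕 → Gs ⊆ members 𝓕 →
  Unique (Fs ++ Gs) →
  Nonempty (⋃ Fs ∩ ⋃ Gs)

{-# OPTIONS --safe #-}

-- Fix s members Fs and let U be their union, so |U| ≤ sk.  If each point of U
-- lies in at most D members of a subfamily Hs, then at most skD members of Hs
-- meet U, and (s,t)-union-intersection forces |Hs| < skD + t.
-- Suppose first that some point v has degree at least tk·C(n-2,k-2) + t.  If
-- s members missed v, take them as Fs and the members through v as Hs: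
-- codegrees are at most D = C(n-2,k-2), a contradiction.  So fewer than s
-- members miss v, and at most C(n-1,k-1) contain it.
-- Otherwise all degrees are O(n^(k-2)), and taking Hs = 𝓕 gives
-- |𝓕| = O(n^(k-2)), which is at most C(n-1,k-1) for large n.

module Submission where

open import Defs
open import Data.Bool using (Bool)
open import Data.Empty using (⊥-elim)
open import Data.Fin using (Fin; zero; suc; punchOut)
open import Data.Fin.Properties using (any?)
open import Data.Fin.Subset using (Subset; Nonempty; ∣_∣; ⋃; inside; outside; _∈_; _∉_)
open import Data.Fin.Subset.Properties using (_∈?_; x∈p∪q⁻; x∈p∩q⁻; ∉⊥)
open import Data.List using (List; []; _∷_; length; map; filter; take; concatMap)
open import Data.List.Membership.Propositional using (find) renaming (_∈_ to _∈ˡ_)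
open import Data.List.Membership.Propositional.Properties using (∈-map⁺; ∈-map⁻; ∈-filter⁻; ∈-concatMap⁺; ∈-concatMap⁻)
open import Data.List.Properties using (length-map; length-++; length-take; filter-none)
open import Data.List.Relation.Binary.Subset.Propositional using (_⊆_)
open import Data.List.Relation.Binary.Subset.Propositional.Properties using (filter-⊆)
import Data.List.Relation.Binary.Sublist.Propositional.Properties as Sublist
import Data.List.Relation.Binary.Sublist.Propositional as Sublist
open import Data.List.Relation.Unary.All as All using (All; []; _∷_)
import Data.List.Relation.Unary.All.Properties as All
open import Data.List.Relation.Unary.AllPairs using ([]; _∷_)
open import Data.List.Relation.Unary.Any as Any using (Any; here; there)
open import Data.List.Relation.Unary.Unique.Propositional using (Unique)
import Data.List.Relation.Unary.Unique.Propositional.Properties as Unique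
open import Data.Nat using (ℕ; zero; suc; _+_; _*_; _∸_; _≤_; _<_; z≤n; s≤s; s≤s⁻¹; _≤?_; >-nonZero)
open import Data.Nat.Combinatorics using (_C_; nC1≡n; nCk+nC[k+1]≡[n+1]C[k+1])
open import Data.Nat.Properties
open import Data.Nat.Tactic.RingSolver using (solve-∀)
open import Data.Product using (∃-syntax; _×_; _,_; proj₂)
open import Data.Sum using (_⊎_; inj₁; inj₂; [_,_])
open import Data.Vec using ([]; _∷_; here; there; lookup; removeAt; insertAt)
open import Data.Vec.Properties using ([]=⇒lookup; lookup⇒[]=; insertAt-removeAt; removeAt-punchOut)
open import Function using (_∘_; id)
open import Level using (Level)
open import Relation.Binary.PropositionalEquality using (_≡_; _≢_; refl; sym; trans; cong; cong₂; subst)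
open import Relation.Nullary using (¬_; yes; no; contradiction)
open import Relation.Unary using (Pred; Decidable)
open import Relation.Unary.Properties using (∁?)

private
  variable
    a p q r : Level
    A : Set a
    n k : ℕ

-- Binomial coefficients.

-- Induction on `n`: Pascal's rule splits the coefficient, and the hypothesis is applied at both `k`
-- and `suc k`. Its role is to show that C(n-1,k-1) exceeds C(n-2,k-2) by the factor (n-1)/(k-1),
-- which outgrows any constant.
C-absorption : ∀ n k → suc n * (n C k) ≡ suc k * (suc n C suc k)
C-absorption zero    zero    = refl
C-absorption zero    (suc k) = sym (*-zeroʳ (suc (suc k)))
C-absorption (suc n) zero    = begin-equality
  suc (suc n) * 1              ≡⟨ *-identityʳ _ ⟩
  suc (suc n)                  ≡⟨ nC1≡n (suc (suc n)) ⟨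
  suc (suc n) C 1              ≡⟨ *-identityˡ _ ⟨
  1 * (suc (suc n) C 1)        ∎
  where open ≤-Reasoning
C-absorption (suc n) (suc k) = begin-equality
  suc (suc n) * x                              ≡⟨ cong (λ z → x + suc n * z) (nCk+nC[k+1]≡[n+1]C[k+1] n k) ⟨
  x + suc n * (n C k + n C suc k)              ≡⟨ cong (x +_) (*-distribˡ-+ (suc n) (n C k) (n C suc k)) ⟩
  x + (suc n * (n C k) + suc n * (n C suc k))  ≡⟨ cong (x +_) (cong₂ _+_ (C-absorption n k) (C-absorption n (suc k))) ⟩
  x + (suc k * x + suc (suc k) * y)            ≡⟨ +-assoc x (suc k * x) _ ⟨
  suc (suc k) * x + suc (suc k) * y            ≡⟨ *-distribˡ-+ (suc (suc k)) x y ⟨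
  suc (suc k) * (x + y)                        ≡⟨ cong (suc (suc k) *_) (nCk+nC[k+1]≡[n+1]C[k+1] (suc n) (suc k)) ⟩
  suc (suc k) * (suc (suc n) C suc (suc k))    ∎
  where
  open ≤-Reasoning
  x = suc n C suc k
  y = suc n C suc (suc k)

k≤n⇒0<nCk : k ≤ n → 0 < n C k
k≤n⇒0<nCk {zero}          _         = s≤s z≤n
k≤n⇒0<nCk {suc k} {suc n} (s≤s k≤n) = begin-strict
  0                   <⟨ k≤n⇒0<nCk k≤n ⟩
  n C k               ≤⟨ m≤m+n _ _ ⟩
  n C k + n C suc k   ≡⟨ nCk+nC[k+1]≡[n+1]C[k+1] n k ⟩
  suc n C suc k       ∎
  where open ≤-Reasoning

-- Counting in filtered lists.

length-filter-∁ : {P : Pred A p} (P? : Decidable P) (xs : List A) →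
                  length (filter P? xs) + length (filter (∁? P?) xs) ≡ length xs
length-filter-∁ P? []       = refl
length-filter-∁ P? (x ∷ xs) with P? x
... | yes _ = cong suc (length-filter-∁ P? xs)
... | no  _ = trans (+-suc _ _) (cong suc (length-filter-∁ P? xs))

length-filter-⊎ : {P : Pred A p} {Q : Pred A q} {R : Pred A r}
                  (P? : Decidable P) (Q? : Decidable Q) (R? : Decidable R) →
                  (∀ {x} → R x → P x ⊎ Q x) → (xs : List A) →
                  length (filter R? xs) ≤ length (filter P? xs) + length (filter Q? xs)
length-filter-⊎ P? Q? R? split []       = z≤n
length-filter-⊎ P? Q? R? split (x ∷ xs) with ih ← length-filter-⊎ P? Q? R? split xs | R? x | P? x | Q? x
... | yes _  | yes _  | yes _  = s≤s (≤-trans ih (+-monoʳ-≤ _ (n≤1+n _)))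
... | yes _  | yes _  | no  _  = s≤s ih
... | yes _  | no  _  | yes _  = ≤-trans (s≤s ih) (≤-reflexive (sym (+-suc _ _)))
... | yes Rx | no ¬Px | no ¬Qx = ⊥-elim ([ ¬Px , ¬Qx ] (split Rx))
... | no _   | yes _  | yes _  = m≤n⇒m≤1+n (≤-trans ih (+-monoʳ-≤ _ (n≤1+n _)))
... | no _   | yes _  | no  _  = m≤n⇒m≤1+n ih
... | no _   | no  _  | yes _  = ≤-trans ih (+-monoʳ-≤ _ (n≤1+n _))
... | no _   | no  _  | no  _  = ih

take-⊆ : ∀ m (xs : List A) → take m xs ⊆ xs
take-⊆ m xs = Sublist.lookup (Sublist.take-⊆ m xs)

length-take-≤ : ∀ {m} (xs : List A) → m ≤ length xs → length (take m xs) ≡ m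
length-take-≤ {m = m} xs m≤ = trans (length-take m xs) (m≤n⇒m⊓n≡m m≤)

-- Points of subsets, and deletion of a point.

∈⋃⁻ : ∀ {x : Fin n} ps → x ∈ ⋃ ps → ∃[ p ] p ∈ˡ ps × x ∈ p
∈⋃⁻ []       x∈ = ⊥-elim (∉⊥ x∈)
∈⋃⁻ (p ∷ ps) x∈ with x∈p∪q⁻ p (⋃ ps) x∈
... | inj₁ x∈p  = p , here refl , x∈p
... | inj₂ x∈ps with q , q∈ps , x∈q ← ∈⋃⁻ ps x∈ps = q , there q∈ps , x∈q

elements : Subset n → List (Fin n)
elements []            = []
elements (inside  ∷ p) = zero ∷ map suc (elements p)
elements (outside ∷ p) = map suc (elements p)

length-elements : (p : Subset n) → length (elements p) ≡ ∣ p ∣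
length-elements []            = refl
length-elements (inside  ∷ p) = cong suc (trans (length-map suc (elements p)) (length-elements p))
length-elements (outside ∷ p) = trans (length-map suc (elements p)) (length-elements p)

∈-elements⁺ : ∀ {x} {p : Subset n} → x ∈ p → x ∈ˡ elements p
∈-elements⁺ here                             = here refl
∈-elements⁺ {p = inside  ∷ _} (there x∈p) = there (∈-map⁺ suc (∈-elements⁺ x∈p))
∈-elements⁺ {p = outside ∷ _} (there x∈p) = ∈-map⁺ suc (∈-elements⁺ x∈p)

∈-elements⁻ : ∀ {x} {p : Subset n} → x ∈ˡ elements p → x ∈ p
∈-elements⁻ {p = inside  ∷ p} (here refl) = here
∈-elements⁻ {p = inside  ∷ p} (there x∈) with _ , y∈ , refl ← ∈-map⁻ suc x∈ = there (∈-elements⁻ y∈)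
∈-elements⁻ {p = outside ∷ p} x∈         with _ , y∈ , refl ← ∈-map⁻ suc x∈ = there (∈-elements⁻ y∈)

∣p∣≡suc[k]⇒Nonempty : {p : Subset n} → ∣ p ∣ ≡ suc k → Nonempty p
∣p∣≡suc[k]⇒Nonempty {p = inside  ∷ p} _  = zero , here
∣p∣≡suc[k]⇒Nonempty {p = outside ∷ p} eq with x , x∈p ← ∣p∣≡suc[k]⇒Nonempty {p = p} eq = suc x , there x∈p

∣removeAt∣ : (p : Subset (suc n)) (v : Fin (suc n)) → v ∈ p → ∣ p ∣ ≡ suc ∣ removeAt p v ∣
∣removeAt∣ (inside  ∷ p)         zero    here        = refl
∣removeAt∣ (inside  ∷ p@(_ ∷ _)) (suc v) (there v∈p) = cong suc (∣removeAt∣ p v v∈p)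
∣removeAt∣ (outside ∷ p@(_ ∷ _)) (suc v) (there v∈p) = ∣removeAt∣ p v v∈p

-- Reinserting the deleted bit recovers the set, so both sets must carry the same bit `b` at `v`.
-- Both values occur below: `inside` for sets through a point, `outside` for sets missing it.
removeAt-injective : (v : Fin (suc n)) {b : Bool} {p q : Subset (suc n)} →
                     lookup p v ≡ b → lookup q v ≡ b → removeAt p v ≡ removeAt q v → p ≡ q
removeAt-injective v {b} {p} {q} pv qv eq = trans (sym (restore p pv)) (trans (cong (λ r → insertAt r v b) eq) (restore q qv))
  where
  restore : ∀ r → lookup r v ≡ b → insertAt (removeAt r v) v b ≡ r
  restore r rv = trans (cong (insertAt (removeAt r v) v) (sym rv)) (insertAt-removeAt r v)

Unique-removeAt : (v : Fin (suc n)) {b : Bool} {ps : List (Subset (suc n))} →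
                  All (λ p → lookup p v ≡ b) ps → Unique ps → Unique (map (λ p → removeAt p v) ps)
Unique-removeAt v []         []           = []
Unique-removeAt v (pv ∷ pvs) (p≢ ∷ ps!) =
  All.map⁺ (All.zipWith (λ (qv , p≢q) eq → p≢q (removeAt-injective v pv qv eq)) (pvs , p≢)) ∷ Unique-removeAt v pvs ps!

-- Size, degree and codegree bounds for uniform families.

mutual
  -- Pascal's rule, split by membership of `zero`. The sets through `zero` are a case of the degree
  -- bound, which deletes a point and returns here with a smaller ground set; hence the mutual
  -- recursion.
  length≤nCk : {ps : List (Subset n)} → Unique ps → All (λ p → ∣ p ∣ ≡ k) ps → length ps ≤ n C k
  length≤nCk {n = zero} {ps = []}               _               _          = z≤n
  length≤nCk {n = zero} {ps = [] ∷ []}          _               (refl ∷ _) = ≤-refl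
  length≤nCk {n = zero} {ps = [] ∷ [] ∷ _}      ((p≢q ∷ _) ∷ _) _          = contradiction refl p≢q
  length≤nCk {n = suc n} {k = k} {ps = ps} ps! sizes = begin
    length ps                  ≡⟨ length-filter-∁ (zero ∈?_) ps ⟨
    length ins + length outs   ≤⟨ +-monoʳ-≤ (length ins) outs≤ ⟩
    length ins + n C k         ≤⟨ ins+nCk≤ k (All.filter⁺ (zero ∈?_) sizes) ⟩
    suc n C k                  ∎
    where
    open ≤-Reasoning
    ins  = filter (zero ∈?_) ps
    outs = filter (∁? (zero ∈?_)) ps

    tail-size : ∀ {p : Subset (suc n)} → zero ∉ p × ∣ p ∣ ≡ k → ∣ removeAt p zero ∣ ≡ k
    tail-size {p = inside  ∷ p} (0∉p , _)  = contradiction here 0∉p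
    tail-size {p = outside ∷ p} (_   , eq) = eq

    head-outside : ∀ {p : Subset (suc n)} → zero ∉ p → lookup p zero ≡ outside
    head-outside {p = inside  ∷ p} 0∉p = contradiction here 0∉p
    head-outside {p = outside ∷ p} _   = refl

    0∉outs : All (zero ∉_) outs
    0∉outs = All.all-filter (∁? (zero ∈?_)) ps

    outs≤ : length outs ≤ n C k
    outs≤ = subst (_≤ n C k) (length-map _ outs)
      (length≤nCk (Unique-removeAt zero (All.map head-outside 0∉outs) (Unique.filter⁺ (∁? (zero ∈?_)) ps!))
        (All.map⁺ (All.zipWith tail-size (0∉outs , All.filter⁺ (∁? (zero ∈?_)) sizes))))

    ins+nCk≤ : ∀ k → All (λ p → ∣ p ∣ ≡ k) ins → length ins + n C k ≤ suc n C k
    -- A set through `zero` is not empty, so `ins` is empty and both coefficients equal 1.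
    ins+nCk≤ zero    ins-sizes with ins | All.all-filter (zero ∈?_) ps
    ... | []               | _        = ≤-refl
    ... | (inside ∷ _) ∷ _ | here ∷ _ = contradiction (All.head ins-sizes) λ ()
    ins+nCk≤ (suc k) ins-sizes = begin
      length ins + n C suc k  ≤⟨ +-monoˡ-≤ _ (degree≤nCk zero (Unique.filter⁺ (zero ∈?_) ps!) ins-sizes (All.all-filter (zero ∈?_) ps)) ⟩
      n C k + n C suc k       ≡⟨ nCk+nC[k+1]≡[n+1]C[k+1] n k ⟩
      suc n C suc k           ∎

  degree≤nCk : (v : Fin (suc n)) {ps : List (Subset (suc n))} → Unique ps →
               All (λ p → ∣ p ∣ ≡ suc k) ps → All (v ∈_) ps → length ps ≤ n C k
  degree≤nCk {n = n} {k = k} v {ps} ps! sizes v∈ = subst (_≤ n C k) (length-map _ ps)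
    (length≤nCk (Unique-removeAt v (All.map []=⇒lookup v∈) ps!)
      (All.map⁺ (All.zipWith (λ {p} (v∈p , eq) → suc-injective (trans (sym (∣removeAt∣ p v v∈p)) eq)) (v∈ , sizes))))

-- Deleting `v` leaves a family still sharing one point, the renumbered `u`, so the degree bound
-- applies.
codegree≤nCk : {v u : Fin (suc (suc n))} → v ≢ u → {ps : List (Subset (suc (suc n)))} → Unique ps →
               All (λ p → ∣ p ∣ ≡ suc (suc k)) ps → All (v ∈_) ps → All (u ∈_) ps → length ps ≤ n C k
codegree≤nCk {n = n} {k = k} {v} {u} v≢u {ps} ps! sizes v∈ u∈ = subst (_≤ n C k) (length-map _ ps)
  (degree≤nCk (punchOut v≢u) (Unique-removeAt v (All.map []=⇒lookup v∈) ps!)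
    (All.map⁺ (All.zipWith (λ {p} (v∈p , eq) → suc-injective (trans (sym (∣removeAt∣ p v v∈p)) eq)) (v∈ , sizes)))
    (All.map⁺ (All.map (λ {p} u∈p → lookup⇒[]= _ _ (trans (removeAt-punchOut p v≢u) ([]=⇒lookup u∈p))) u∈)))

-- Sets meeting a union, and the use of union-intersection.

meets? : (us : List (Fin n)) → Decidable (λ p → Any (_∈ p) us)
meets? us p = Any.any? (_∈? p) us

length-meets≤ : ∀ {D} (us : List (Fin n)) (ps : List (Subset n)) →
                (∀ {u} → u ∈ˡ us → length (filter (u ∈?_) ps) ≤ D) →
                length (filter (meets? us) ps) ≤ length us * D
length-meets≤ []       ps deg≤ = ≤-reflexive (cong length (filter-none (meets? []) (All.universal (λ _ ()) ps)))
length-meets≤ (u ∷ us) ps deg≤ = ≤-trans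
  (length-filter-⊎ (u ∈?_) (meets? us) (meets? (u ∷ us)) Any.toSum ps)
  (+-mono-≤ (deg≤ (here refl)) (length-meets≤ us ps (deg≤ ∘ there)))

length-concatMap-elements : (ps : List (Subset n)) → All (λ p → ∣ p ∣ ≡ k) ps →
                            length (concatMap elements ps) ≡ length ps * k
length-concatMap-elements []       []              = refl
length-concatMap-elements (p ∷ ps) (size ∷ sizes) = trans (length-++ (elements p))
  (cong₂ _+_ (trans (length-elements p) size) (length-concatMap-elements ps sizes))

module _ {s t} (𝓕 : SetSystem n) (uniform : Uniform (suc k) 𝓕) (inter : UnionIntersecting s t 𝓕) where

  -- Otherwise at least `t` members of `Hs` avoid the union of `Fs`, and `t` of them serve as `Gs`.
  -- Degrees are bounded only at points of `Fs`, so that when `Hs` passes through a point missed by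
  -- `Fs`, a codegree bound is enough.
  length<skD+t : ∀ {D} {Fs Hs : List (Subset n)} → length Fs ≡ s →
                 Unique Fs → Fs ⊆ members 𝓕 → Unique Hs → Hs ⊆ members 𝓕 →
                 (∀ {F u} → F ∈ˡ Fs → u ∈ F → length (filter (u ∈?_) Hs) ≤ D) →
                 length Hs < s * suc k * D + t
  length<skD+t {D} {Fs} {Hs} ∣Fs∣ Fs! Fs⊆ Hs! Hs⊆ deg≤ = ≰⇒> λ skD+t≤ →
    let
      t≤ : t ≤ length missing
      t≤ = +-cancelˡ-≤ (s * suc k * D) _ _ (begin
        s * suc k * D + t                                     ≤⟨ skD+t≤ ⟩
        length Hs                                             ≡⟨ length-filter-∁ (meets? us) Hs ⟨
        length (filter (meets? us) Hs) + length missing       ≤⟨ +-monoˡ-≤ _ meeting≤ ⟩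
        s * suc k * D + length missing                        ∎)
      -- `Hs` may overlap `Fs`, but `Gs` cannot: a common set has size `suc k`, so it has a point,
      -- which would lie in the union that `Gs` avoids.
      x , x∈ = inter Fs Gs ∣Fs∣ (length-take-≤ missing t≤) Fs⊆ Gs⊆ (Unique.++⁺ Fs! Gs! λ (p∈Fs , p∈Gs) →
        let _ , x∈p = ∣p∣≡suc[k]⇒Nonempty (All.lookup uniform (Fs⊆ p∈Fs)) in apart p∈Fs x∈p p∈Gs x∈p)
      x∈⋃Fs , x∈⋃Gs = x∈p∩q⁻ (⋃ Fs) (⋃ Gs) x∈
      _ , F∈ , x∈F = ∈⋃⁻ Fs x∈⋃Fs
      _ , G∈ , x∈G = ∈⋃⁻ Gs x∈⋃Gs
    in apart F∈ x∈F G∈ x∈G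
    where
    open ≤-Reasoning
    -- A point in several members of `Fs` is repeated, which makes the length exactly `s * suc k`
    -- and is harmless in a union bound.
    us      = concatMap elements Fs
    missing = filter (∁? (meets? us)) Hs
    Gs      = take t missing

    Gs! : Unique Gs
    Gs! = Unique.take⁺ t (Unique.filter⁺ (∁? (meets? us)) Hs!)

    Gs⊆ : Gs ⊆ members 𝓕
    Gs⊆ = Hs⊆ ∘ filter-⊆ (∁? (meets? us)) Hs ∘ take-⊆ t missing

    apart : ∀ {F G x} → F ∈ˡ Fs → x ∈ F → G ∈ˡ Gs → ¬ (x ∈ G)
    apart F∈ x∈F G∈ x∈G = proj₂ (∈-filter⁻ (∁? (meets? us)) {xs = Hs} (take-⊆ t missing G∈))
      (Any.map (λ { refl → x∈G }) (∈-concatMap⁺ elements (Any.map (λ { refl → ∈-elements⁺ x∈F }) F∈)))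

    deg-us : ∀ {u} → u ∈ˡ us → length (filter (u ∈?_) Hs) ≤ D
    deg-us u∈ with _ , F∈ , u∈F ← find (∈-concatMap⁻ elements {xs = Fs} u∈) = deg≤ F∈ (∈-elements⁻ u∈F)

    meeting≤ : length (filter (meets? us) Hs) ≤ s * suc k * D
    meeting≤ = begin
      length (filter (meets? us) Hs)  ≤⟨ length-meets≤ us Hs deg-us ⟩
      length us * D                   ≡⟨ cong (_* D) (trans (length-concatMap-elements Fs (All.anti-mono Fs⊆ uniform)) (cong (_* suc k) ∣Fs∣)) ⟩
      s * suc k * D                   ∎

-- With all degrees below tk·c + t, where c = C(n-2,k-2), at most factor · c
-- members meet a union of t members or are among t further ones.
factor : ℕ → ℕ → ℕ
factor k t = t * k * (t * k + t) + t

-- The summand `k` keeps C(n-2,k-2) positive; the other is what absorption requires once the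
-- denominator `k ∸ 1` is cleared.
threshold : ℕ → ℕ → ℕ
threshold k t = k + (k ∸ 1) * factor k t

-- Here `j` is k-2 and `m` is n-2. After multiplication by `suc j`, absorption makes the right side
-- `suc m * c`, so it remains to make the left side a multiple of `c` as well.
degree-bound≤ : ∀ t j m → j ≤ m → suc j * factor (suc (suc j)) t ≤ suc m →
                t * suc (suc j) * (t * suc (suc j) * (m C j) + t) + t ≤ suc m C suc j
degree-bound≤ t j m j≤m large = *-cancelˡ-≤ (suc j) (begin
  -- Since `c` is at least 1, each lone `t` may be raised to `t * c`.
  suc j * (tk * (tk * c + t) + t)              ≤⟨ *-monoʳ-≤ (suc j) (+-mono-≤ (*-monoʳ-≤ tk (+-monoʳ-≤ (tk * c) t≤tc)) t≤tc) ⟩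
  suc j * (tk * (tk * c + t * c) + t * c)      ≡⟨ collect (suc j) tk c t ⟩
  suc j * (tk * (tk + t) + t) * c              ≤⟨ *-monoˡ-≤ c large ⟩
  suc m * c                                    ≡⟨ C-absorption m j ⟩
  suc j * (suc m C suc j)                      ∎)
  where
  open ≤-Reasoning
  tk = t * suc (suc j)
  c  = m C j

  t≤tc : t ≤ t * c
  t≤tc = m≤m*n t c {{>-nonZero (k≤n⇒0<nCk j≤m)}}

  collect : ∀ i x c t → i * (x * (x * c + t * c) + t * c) ≡ i * (x * (x + t) + t) * c
  collect = solve-∀

-- Case split on the existence of a point of large degree.

theorem4p1 : ∀ (k t : ℕ) → 2 ≤ k →
    ∃[ N ] (∀ (s n : ℕ) → 1 ≤ s → s ≤ t → N < n →
    (𝓕 : SetSystem n) → Uniform k 𝓕 → UnionIntersecting s t 𝓕 →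
    size 𝓕 ≤ ((n ∸ 1) C (k ∸ 1)) + (s ∸ 1))
theorem4p1 (suc zero) _ (s≤s ())
theorem4p1 k@(suc (suc j)) t _ = threshold k t , bound
  where
  bound : ∀ (s n : ℕ) → 1 ≤ s → s ≤ t → threshold k t < n →
          (𝓕 : SetSystem n) → Uniform k 𝓕 → UnionIntersecting s t 𝓕 →
          size 𝓕 ≤ ((n ∸ 1) C (k ∸ 1)) + (s ∸ 1)
  -- From here on `s` is one less than in the statement, so `s≤t` reads `suc s ≤ t`. The threshold
  -- is at least 2, which excludes smaller `n`.
  bound (suc s) (suc (suc m)) _ s≤t (s≤s N≤) 𝓕 uniform inter = conclude
    where
    open ≤-Reasoning
    ps = members 𝓕
    c  = m C j
    D  = t * k * c + t

    j≤m : j ≤ m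
    j≤m = s≤s⁻¹ (m+n≤o⇒m≤o (suc j) (≤-trans (n≤1+n _) N≤))

    -- Replacing `suc s` by `t` removes the dependence on `s` from the threshold.
    big : ∀ {d} → suc s * k * d + t ≤ t * k * d + t
    big {d} = +-monoˡ-≤ t (*-monoˡ-≤ d (*-monoˡ-≤ k s≤t))

    few-missing : ∀ v → D ≤ length (filter (v ∈?_) ps) → length (filter (∁? (v ∈?_)) ps) ≤ s
    few-missing v D≤ = s≤s⁻¹ (≰⇒> λ s<out → <⇒≱ (length<skD+t 𝓕 uniform inter
        (length-take-≤ outs s<out)
        (Unique.take⁺ (suc s) (Unique.filter⁺ (∁? (v ∈?_)) (distinct 𝓕)))
        (filter-⊆ (∁? (v ∈?_)) ps ∘ take-⊆ (suc s) outs)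
        (Unique.filter⁺ (v ∈?_) (distinct 𝓕)) (filter-⊆ (v ∈?_) ps) codegree≤)
      (≤-trans big D≤))
      where
      ins  = filter (v ∈?_) ps
      outs = filter (∁? (v ∈?_)) ps

      codegree≤ : ∀ {F u} → F ∈ˡ take (suc s) outs → u ∈ F → length (filter (u ∈?_) ins) ≤ c
      codegree≤ {u = u} F∈ u∈F = codegree≤nCk
        -- `u` differs from `v` because it lies in a set chosen to miss `v`.
        (λ { refl → proj₂ (∈-filter⁻ (∁? (v ∈?_)) {xs = ps} (take-⊆ (suc s) outs F∈)) u∈F })
        (Unique.filter⁺ (u ∈?_) (Unique.filter⁺ (v ∈?_) (distinct 𝓕)))
        (All.filter⁺ (u ∈?_) (All.filter⁺ (v ∈?_) uniform))
        (All.filter⁺ (u ∈?_) (All.all-filter (v ∈?_) ps))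
        (All.all-filter (u ∈?_) ins)

    conclude : size 𝓕 ≤ (suc m C suc j) + s
    conclude with any? (λ v → D ≤? length (filter (v ∈?_) ps))
    ... | yes (v , D≤) = begin
      length ps
        ≡⟨ length-filter-∁ (v ∈?_) ps ⟨
      length (filter (v ∈?_) ps) + length (filter (∁? (v ∈?_)) ps)
        ≤⟨ +-mono-≤ (degree≤nCk v (Unique.filter⁺ (v ∈?_) (distinct 𝓕))
                      (All.filter⁺ (v ∈?_) uniform) (All.all-filter (v ∈?_) ps))
                    (few-missing v D≤) ⟩
      (suc m C suc j) + s ∎
    ... | no ¬D≤ with suc s ≤? length ps
    -- Too few members to choose `Fs`: the summand `s` alone covers the family.
    ...   | no s≮ = ≤-trans (s≤s⁻¹ (≰⇒> s≮)) (m≤n+m s _)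
    ...   | yes s< = begin
      length ps              ≤⟨ <⇒≤ (length<skD+t 𝓕 uniform inter (length-take-≤ ps s<)
                                  (Unique.take⁺ (suc s) (distinct 𝓕)) (take-⊆ (suc s) ps)
                                  -- `Hs` is the whole family, and every degree is at most `D`
                                  -- because no point reaches it.
                                  (distinct 𝓕) id (λ {_} {u} _ _ → ≰⇒≥ λ D≤ → ¬D≤ (u , D≤))) ⟩
      suc s * k * D + t      ≤⟨ big ⟩
      t * k * D + t          ≤⟨ degree-bound≤ t j m j≤m (m+n≤o⇒n≤o k N≤) ⟩
      suc m C suc j          ≤⟨ m≤m+n _ s ⟩
      (suc m C suc j) + s    ∎
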